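{- $N(35) \ge 6$; that is, there exist $6$ mutually orthogonal Latin squares of order $35$.
   Context: A Latin square of order $n$ on an $n$-element set $V$ is an $n\times n$ matrix every row and every column of which is a permutation of $V$. Two Latin squares $L_1=(v_{ij})$ and $L_2=(w_{ij})$ of order $n$ (on symbol sets $V$, $W$ of size $n$) are orthogonal if the $n^2$ pairs $(v_{ij},w_{ij})$ are all distinct, i.e. they exhaust $V\times W$. A set of Latin squares is a set of mutually orthogonal Latin squares (MOLS) if any two of them are orthogonal. $N(n)$ denotes the largest size of a set of MOLS of order $n$. -}

module Defs where

open import Data.Nat using (ℕ)
open import Data.Fin using (Fin)
open import Data.Product using (Σ; _×_; _,_)
open import Relation.Binary.PropositionalEquality using (_≡_)
open import Relation.Nullary using (¬_)
open import Function.Definitions using (Bijective; Injective)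

Square : ℕ → Set
Square n = Fin n → Fin n → Fin n

IsLatin : ∀ {n} → Square n → Set
IsLatin {n} L =
  ((i : Fin n) → Bijective _≡_ _≡_ (λ j → L i j)) ×
  ((j : Fin n) → Bijective _≡_ _≡_ (λ i → L i j))

Orthogonal : ∀ {n} → Square n → Square n → Set
Orthogonal {n} L₁ L₂ =
  Bijective {A = Fin n × Fin n} {B = Fin n × Fin n} _≡_ _≡_
    (λ { (i , j) → (L₁ i j , L₂ i j) })

IsMOLS : ∀ {n k} → (Fin k → Square n) → Set
IsMOLS {n} {k} Ls =
  ((a : Fin k) → IsLatin (Ls a)) ×
  ((a b : Fin k) → ¬ (a ≡ b) → Orthogonal (Ls a) (Ls b))

MOLSExist : ℕ → ℕ → Set
MOLSExist n k = Σ (Fin k → Square n) IsMOLS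

{-# OPTIONS --safe #-}
-- A difference matrix over a group of order n with k + 1 rows (any two rows
-- have a bijective quotient) yields k mutually orthogonal Latin squares of
-- order n: normalise row 0 to be trivial and let the group translate each of
-- the other rows.  Over ℤ/35 there is a difference matrix with 7 rows that is
-- invariant under cyclic shifts of the rows: its 35 columns are all the rotations
-- of 5 base columns.
module Submission where

open import Defs
open import Algebra.Bundles using (Group)
open import Algebra.Structures using (IsGroup)
import Algebra.Properties.Group as GroupProperties
open import Data.Fin using (Fin; zero; suc; toℕ; punchOut; remQuot)
open import Data.Fin.Properties using (_≟_; all?; any?; toℕ<n; toℕ-fromℕ<; toℕ-injective; punchOut-injective; injective⇒≤; 0≢1+n; suc-injective)
open import Data.Nat using (ℕ; suc; _+_; _∸_; _%_; NonZero)
open import Data.Nat.DivMod using (_mod_; m%n<n; %-distribˡ-+; n%n≡0; m*n%n≡0; m<n⇒m%n≡m)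
open import Data.Nat.Properties using (+-assoc; +-comm; +-identityʳ; m+[n∸m]≡n; <⇒≤; 1+n≰n)
open import Data.Product using (_×_; _,_; proj₁; proj₂)
open import Data.Vec using (Vec; lookup; []; _∷_)
open import Function using (_∘_)
open import Function.Consequences.Propositional using (strictlySurjective⇒surjective)
open import Function.Construct.Composition using (bijective)
open import Function.Definitions using (Bijective; Injective; StrictlySurjective)
open import Level using (0ℓ)
open import Relation.Binary.PropositionalEquality using (_≡_; _≢_; refl; sym; trans; cong; cong₂; isEquivalence; module ≡-Reasoning)
open import Relation.Nullary using (Dec; yes; no; ¬?; contradiction)
open import Relation.Nullary.Decidable using (_→-dec_; from-yes)

-- Pigeonhole: if `f` missed `y`, punching `y` out of the codomain would leave an injection of
-- `Fin (suc n)` into `Fin n`.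
injective⇒strictlySurjective : ∀ {n} {f : Fin n → Fin n} →
  Injective _≡_ _≡_ f → StrictlySurjective _≡_ f
injective⇒strictlySurjective {suc n} {f} f-injective y
  with any? (λ x → f x ≟ y)
... | yes y∈im = y∈im
... | no  y∉im = contradiction (injective⇒≤ avoid-injective) 1+n≰n
  where
  y≢f : ∀ x → y ≢ f x
  y≢f x y≡fx = y∉im (x , sym y≡fx)

  avoid-injective : Injective _≡_ _≡_ (λ x → punchOut (y≢f x))
  avoid-injective {x} {x′} = f-injective ∘ punchOut-injective (y≢f x) (y≢f x′)

injective⇒bijective : ∀ {n} {f : Fin n → Fin n} →
  Injective _≡_ _≡_ f → Bijective _≡_ _≡_ f
injective⇒bijective f-injective =
  f-injective , strictlySurjective⇒surjective (injective⇒strictlySurjective f-injective)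

module _ {n : ℕ} {_∙_ : Fin n → Fin n → Fin n} {ε : Fin n} {_⁻¹ : Fin n → Fin n}
         (isGroup : IsGroup _≡_ _∙_ ε _⁻¹) where

  private
    G : Group 0ℓ 0ℓ
    G = record { isGroup = isGroup }

  open Group G using (_//_; assoc)
  open GroupProperties G using (∙-cancelˡ; ∙-cancelʳ; ⁻¹-injective; ⁻¹-anti-homo-//; //-rightDividesˡ; //-rightDividesʳ)
  open ≡-Reasoning

  IsDifferenceMatrix : ∀ {k} → (Fin k → Fin n → Fin n) → Set
  IsDifferenceMatrix r = ∀ a b → a ≢ b → Bijective _≡_ _≡_ (λ c → r a c // r b c)

  translate : (Fin n → Fin n) → Square n
  translate r c g = r c ∙ g

  quotient-chain : ∀ x y z → (x // y) ∙ (y // z) ≡ x // z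
  quotient-chain x y z = begin
    (x // y) ∙ (y // z)   ≡⟨ assoc (x // y) y (z ⁻¹) ⟨
    ((x // y) ∙ y) // z   ≡⟨ cong (_// z) (//-rightDividesˡ y x) ⟩
    x // z                ∎

  quotient-cancelʳ : ∀ x y z → (x // z) // (y // z) ≡ x // y
  quotient-cancelʳ x y z = begin
    (x // z) // (y // z)  ≡⟨ cong ((x // z) ∙_) (⁻¹-anti-homo-// y z) ⟩
    (x // z) ∙ (z // y)   ≡⟨ quotient-chain x z y ⟩
    x // y                ∎

  -- Dividing both factors by `g` leaves the quotient unchanged. Hence in cell `(c , g)` of two
  -- translated squares the quotient of the entries depends on `c` alone.
  translates-quotient : ∀ x y g → (x ∙ g) // (y ∙ g) ≡ x // y
  translates-quotient x y g = begin
    (x ∙ g) // (y ∙ g)                ≡⟨ quotient-cancelʳ (x ∙ g) (y ∙ g) g ⟨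
    ((x ∙ g) // g) // ((y ∙ g) // g)  ≡⟨ cong₂ _//_ (//-rightDividesʳ g x) (//-rightDividesʳ g y) ⟩
    x // y                            ∎

  ∙ˡ-injective : ∀ x → Injective _≡_ _≡_ (x ∙_)
  ∙ˡ-injective x = ∙-cancelˡ x _ _

  ∙ʳ-injective : ∀ y → Injective _≡_ _≡_ (_∙ y)
  ∙ʳ-injective y = ∙-cancelʳ y _ _

  -- A row is a left translation of the group; a column is `r` followed by a right translation.
  translate-latin : ∀ {r} → Bijective _≡_ _≡_ r → IsLatin (translate r)
  translate-latin {r} r-bijective =
    (λ c → injective⇒bijective (∙ˡ-injective (r c))) ,
    (λ g → bijective _≡_ _≡_ _≡_ r-bijective (injective⇒bijective (∙ʳ-injective g)))

  -- A pair of entries can be decoded: its quotient gives `c`, and then the first entry gives `g` by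
  -- cancelling `r c`.
  translate-orthogonal : ∀ {r s} → Bijective _≡_ _≡_ (λ c → r c // s c) →
                         Orthogonal (translate r) (translate s)
  translate-orthogonal {r} {s} (r//s-injective , r//s-surjective) =
    injective , strictlySurjective⇒surjective surjective
    where
    pair : Fin n × Fin n → Fin n × Fin n
    pair (c , g) = translate r c g , translate s c g

    injective : Injective _≡_ _≡_ pair
    injective {c , g} {c′ , g′} eq with r//s-injective quotients-equal
      where
      quotients-equal : r c // s c ≡ r c′ // s c′
      quotients-equal = begin
        r c // s c                      ≡⟨ translates-quotient (r c) (s c) g ⟨
        (r c ∙ g) // (s c ∙ g)          ≡⟨ cong₂ _//_ (cong proj₁ eq) (cong proj₂ eq) ⟩
        (r c′ ∙ g′) // (s c′ ∙ g′)      ≡⟨ translates-quotient (r c′) (s c′) g′ ⟩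
        r c′ // s c′                    ∎
    ... | refl = cong (c ,_) (∙ˡ-injective (r c) (cong proj₁ eq))

    surjective : StrictlySurjective _≡_ pair
    surjective (x , y) with r//s-surjective (x // y)
    ... | c , at-c with injective⇒strictlySurjective (∙ˡ-injective (r c)) x
    ... | g , refl = (c , g) , cong (r c ∙ g ,_) (sym y≡)
      where
      x//y≡ : (r c ∙ g) // y ≡ (r c ∙ g) // (s c ∙ g)
      x//y≡ = trans (sym (at-c refl)) (sym (translates-quotient (r c) (s c) g))

      -- `g` was chosen to match the first entry only; the second is then forced, because the
      -- quotients agree.
      y≡ : y ≡ s c ∙ g
      y≡ = ⁻¹-injective (∙ˡ-injective (r c ∙ g) x//y≡)

  -- Each `normalised a` is itself a quotient against row `zero`, hence bijective, which makes the
  -- square Latin. Dividing by that common row preserves the quotients among the other `k` rows,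
  -- which gives orthogonality.
  differenceMatrix⇒MOLS : ∀ {k} (r : Fin (suc k) → Fin n → Fin n) →
                          IsDifferenceMatrix r → MOLSExist n k
  differenceMatrix⇒MOLS {k} r isDM =
    (λ a → translate (normalised a)) ,
    (λ a → translate-latin (isDM (suc a) zero (0≢1+n ∘ sym))) ,
    (λ a b a≢b → translate-orthogonal (quotient-bijective a b a≢b))
    where
    normalised : Fin k → Fin n → Fin n
    normalised a c = r (suc a) c // r zero c

    quotient-bijective : ∀ a b → a ≢ b →
      Bijective _≡_ _≡_ (λ c → normalised a c // normalised b c)
    quotient-bijective a b a≢b = injective⇒bijective λ {c} {c′} eq →
      proj₁ (isDM (suc a) (suc b) (a≢b ∘ suc-injective))
        (trans (sym (cancel c)) (trans eq (cancel c′)))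
      where
      cancel : ∀ c → normalised a c // normalised b c ≡ r (suc a) c // r (suc b) c
      cancel c = quotient-cancelʳ (r (suc a) c) (r (suc b) c) (r zero c)

module _ {n : ℕ} .{{_ : NonZero n}} where

  open ≡-Reasoning

  infixl 6 _⊕_
  infix  8 ⊖_

  _⊕_ : Fin n → Fin n → Fin n
  x ⊕ y = (toℕ x + toℕ y) mod n

  𝟘 : Fin n
  𝟘 = 0 mod n

  ⊖_ : Fin n → Fin n
  -- For `x` zero the difference is `n` itself, which the reduction sends back to zero.
  ⊖ x = (n ∸ toℕ x) mod n

  toℕ-mod : ∀ m → toℕ (m mod n) ≡ m % n
  toℕ-mod m = toℕ-fromℕ< (m%n<n m n)

  toℕ-% : ∀ (x : Fin n) → toℕ x % n ≡ toℕ x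
  toℕ-% x = m<n⇒m%n≡m (toℕ<n x)

  mod-cong : ∀ {l m} → l % n ≡ m % n → l mod n ≡ m mod n
  mod-cong {l} {m} eq = toℕ-injective (trans (toℕ-mod l) (trans eq (sym (toℕ-mod m))))

  toℕ-mod-inverse : ∀ x → toℕ x mod n ≡ x
  toℕ-mod-inverse x = toℕ-injective (trans (toℕ-mod (toℕ x)) (toℕ-% x))

  -- The bridge by which the group laws descend from `ℕ`: once each `x` is rewritten as
  -- `toℕ x mod n`, sums can be rearranged before reduction.
  mod-⊕ : ∀ l m → (l mod n) ⊕ (m mod n) ≡ (l + m) mod n
  mod-⊕ l m = mod-cong (begin
    (toℕ (l mod n) + toℕ (m mod n)) % n  ≡⟨ cong₂ (λ a b → (a + b) % n) (toℕ-mod l) (toℕ-mod m) ⟩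
    (l % n + m % n) % n                  ≡⟨ %-distribˡ-+ l m n ⟨
    (l + m) % n                          ∎)

  ⊕-comm : ∀ x y → x ⊕ y ≡ y ⊕ x
  ⊕-comm x y = cong (_mod n) (+-comm (toℕ x) (toℕ y))

  ⊕-assoc : ∀ x y z → (x ⊕ y) ⊕ z ≡ x ⊕ (y ⊕ z)
  ⊕-assoc x y z = begin
    (x ⊕ y) ⊕ z                         ≡⟨ cong (x ⊕ y ⊕_) (toℕ-mod-inverse z) ⟨
    (x ⊕ y) ⊕ (toℕ z mod n)             ≡⟨ mod-⊕ (toℕ x + toℕ y) (toℕ z) ⟩
    (toℕ x + toℕ y + toℕ z) mod n       ≡⟨ cong (_mod n) (+-assoc (toℕ x) (toℕ y) (toℕ z)) ⟩
    (toℕ x + (toℕ y + toℕ z)) mod n     ≡⟨ mod-⊕ (toℕ x) (toℕ y + toℕ z) ⟨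
    (toℕ x mod n) ⊕ (y ⊕ z)             ≡⟨ cong (_⊕ (y ⊕ z)) (toℕ-mod-inverse x) ⟩
    x ⊕ (y ⊕ z)                         ∎

  ⊕-identityʳ : ∀ x → x ⊕ 𝟘 ≡ x
  ⊕-identityʳ x = begin
    x ⊕ 𝟘                    ≡⟨ cong (_⊕ 𝟘) (toℕ-mod-inverse x) ⟨
    (toℕ x mod n) ⊕ 𝟘        ≡⟨ mod-⊕ (toℕ x) 0 ⟩
    (toℕ x + 0) mod n        ≡⟨ cong (_mod n) (+-identityʳ (toℕ x)) ⟩
    toℕ x mod n              ≡⟨ toℕ-mod-inverse x ⟩
    x                        ∎

  ⊕-inverseʳ : ∀ x → x ⊕ ⊖ x ≡ 𝟘
  ⊕-inverseʳ x = begin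
    x ⊕ ⊖ x                        ≡⟨ cong (_⊕ ⊖ x) (toℕ-mod-inverse x) ⟨
    (toℕ x mod n) ⊕ ⊖ x            ≡⟨ mod-⊕ (toℕ x) (n ∸ toℕ x) ⟩
    (toℕ x + (n ∸ toℕ x)) mod n    ≡⟨ cong (_mod n) (m+[n∸m]≡n (<⇒≤ (toℕ<n x))) ⟩
    -- `0 * n` computes to `0`, so `m*n%n≡0 0 n` supplies `0 % n ≡ 0`.
    n mod n                        ≡⟨ mod-cong (trans (n%n≡0 n) (sym (m*n%n≡0 0 n))) ⟩
    𝟘                              ∎

  ⊕-isGroup : IsGroup _≡_ _⊕_ 𝟘 ⊖_
  ⊕-isGroup = record
    { isMonoid = record
      { isSemigroup = record
        { isMagma = record { isEquivalence = isEquivalence ; ∙-cong = cong₂ _⊕_ }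
        ; assoc   = ⊕-assoc
        }
      ; identity = (λ x → trans (⊕-comm 𝟘 x) (⊕-identityʳ x)) , ⊕-identityʳ
      }
    ; inverse = (λ x → trans (⊕-comm (⊖ x) x) (⊕-inverseʳ x)) , ⊕-inverseʳ
    ; ⁻¹-cong = cong ⊖_
    }

-- Writing A for the first column, the next two are μ A and μ² A, where
-- (μ A)₂ᵢ = 16 Aᵢ with indices mod 7; the last two columns are fixed by μ.
-- A computer search over such μ-invariant families found these values.
baseColumns : Vec (Vec ℕ 7) 5
baseColumns =
  (0 ∷  0 ∷  1 ∷ 18 ∷ 30 ∷ 32 ∷ 29 ∷ []) ∷
  (0 ∷ 25 ∷  0 ∷ 22 ∷ 16 ∷  9 ∷  8 ∷ []) ∷
  (0 ∷ 11 ∷ 15 ∷  4 ∷  0 ∷ 23 ∷  2 ∷ []) ∷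
  (0 ∷  8 ∷ 23 ∷ 32 ∷ 18 ∷  2 ∷ 22 ∷ []) ∷
  (0 ∷ 16 ∷ 11 ∷ 29 ∷  1 ∷  4 ∷  9 ∷ []) ∷ []

-- `remQuot` splits `c` as `7 t + s`: base column `t` rotated by `s` places. Here `⊕` adds indices
-- modulo 7, whereas the entries live modulo 35.
matrix : Fin 7 → Fin 35 → Fin 35
matrix a c with remQuot {5} 7 c
... | t , s = lookup (lookup baseColumns t) (s ⊕ a) mod 35

injective? : ∀ {n} (f : Fin n → Fin n) → Dec (∀ x y → f x ≡ f y → x ≡ y)
injective? f = all? λ x → all? λ y → (f x ≟ f y) →-dec (x ≟ y)

-- Checked by evaluation: `from-yes` type-checks because the decision over all rows and columns
-- computes to `yes`. Testing injectivity is enough on a finite set, and the explicit `x` and `y`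
-- match the form that `all?` decides.
matrix-differences-injective : ∀ a b → a ≢ b →
  ∀ x y → matrix a x ⊕ ⊖ matrix b x ≡ matrix a y ⊕ ⊖ matrix b y → x ≡ y
matrix-differences-injective = from-yes
  (all? λ a → all? λ b → ¬? (a ≟ b) →-dec injective? (λ c → matrix a c ⊕ ⊖ matrix b c))

matrix-isDifferenceMatrix : IsDifferenceMatrix ⊕-isGroup matrix
matrix-isDifferenceMatrix a b a≢b =
  injective⇒bijective (matrix-differences-injective a b a≢b _ _)

theorem2 : MOLSExist 35 6
theorem2 = differenceMatrix⇒MOLS ⊕-isGroup matrix matrix-isDifferenceMatrix
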